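{- Suppose $(\varepsilon,\beta,\gamma;(12))\in\mathrm{Par}(n)$. Fix an integer $d>1$, and let $r$ be the number of cycles of $\beta$ of length $d$; suppose $r$ is odd. Let $\Gamma$ be the set of all cycles $C$ of $\gamma$ (including fixed points as cycles of length $1$) satisfying all of: <ul> <li>(i) $o(C)$ is an odd divisor of $d$;</li> <li>(ii) $\beta$ has no cycle $C'$ with $1<o(C')<d$ and $\operatorname{lcm}(o(C),o(C'))=d$;</li> <li>(iii) if the number of fixed points of $\beta$ is odd, then $o(C)<d$.</li> </ul> Then $\Gamma=\emptyset$ if $d$ is even, and $|\Gamma|\le r$ if $d$ is odd.
   Context: A Latin square of order $n$ is an $n\times n$ array with rows, columns and symbols indexed by $[n]$, each symbol occurring once in each row and each column, with triple set $O(L)$. Permutations act on the right; $\varepsilon$ is the identity. $o(C)$ is the length of a cycle $C$. A paratopism $(\alpha,\beta,\gamma;(12))$ maps $L$ to $L^\sigma$ with triple set $\{(y\beta,x\alpha,z\gamma):(x,y,z)\in O(L)\}$; it is an autoparatopism of $L$ if $L^\sigma=L$. $\mathrm{Par}(n)$ is the set of paratopisms that are autoparatopisms of at least one Latin square of order $n$. -}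

module Defs where

open import Data.Bool using (true; false)
import Data.Bool.Properties as Bool
open import Data.Empty using (⊥-elim)
open import Data.Fin using (Fin; toℕ; fromℕ<)
open import Data.Fin.Permutation using (Permutation′; _⟨$⟩ʳ_; _⟨$⟩ˡ_; inverseˡ)
open import Data.Fin.Properties using (_≟_; any?; pigeonhole; toℕ-fromℕ<; toℕ≤pred[n])
open import Data.Fin.Subset using (Subset; ∣_∣) renaming (_∈_ to _∈ˢ_)
open import Data.List using (List; length; map; filter; deduplicate; allFin)
open import Data.List.Membership.Propositional using (_∈_)
open import Data.List.Membership.Propositional.Properties using (∈-map⁺; ∈-map⁻; ∈-allFin; ∈-deduplicate⁺; ∈-deduplicate⁻)
open import Data.List.Relation.Unary.Any as Any using (Any)
open import Data.List.Relation.Unary.Unique.Propositional using (Unique)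
import Data.List.Relation.Unary.Unique.DecPropositional.Properties as DecUnique
open import Data.Nat using (ℕ; zero; suc; _*_; _∸_; _<_; _≤_; NonZero; >-nonZero)
import Data.Nat.Properties as ℕ
open import Data.Nat.Divisibility using (_∣_; _∣?_)
open import Data.Nat.DivMod using (_%_; _/_; m≡m%n+[m/n]*n; m%n<n)
open import Data.Nat.GeneralisedArithmetic using (fold; fold-+)
open import Data.Nat.LCM using (lcm)
open import Data.Product using (_×_; _,_; ∃; ∃!; ∃-syntax)
open import Data.Vec using (tabulate)
open import Data.Vec.Properties using (≡-dec; lookup∘tabulate; []=⇒lookup; lookup⇒[]=; tabulate∘lookup; tabulate-cong)
open import Function using (_⇔_; mk⇔; Equivalence)
open import Relation.Binary using (DecidableEquality)
open import Relation.Binary.PropositionalEquality using (_≡_; refl; sym; trans; cong; subst)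
open import Relation.Nullary using (¬_; Dec; yes; no; does; ¬?; _×-dec_; _→-dec_)
open import Relation.Unary using (Pred; Decidable)
open import Level using (0ℓ)

Even Odd : ℕ → Set
Even m = 2 ∣ m
Odd m = ¬ Even m

odd? : Decidable Odd
odd? m = ¬? (2 ∣? m)

Triple : ℕ → Set
Triple n = Fin n × Fin n × Fin n

record LatinSquare (n : ℕ) : Set where
  field
    entry    : Fin n → Fin n → Fin n
    rowLatin : ∀ x z → ∃! _≡_ λ y → entry x y ≡ z
    colLatin : ∀ y z → ∃! _≡_ λ x → entry x y ≡ z

open LatinSquare public

O : ∀ {n} → LatinSquare n → Pred (Triple n) 0ℓ
O L (x , y , z) = entry L x y ≡ z

-- The paratopisms (α, β, γ; (12)), i.e. those whose S₃-component is (12).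
record Paratopism₁₂ (n : ℕ) : Set where
  constructor ⟨_,_,_⨾12⟩
  field
    α β γ : Permutation′ n

-- The triple set of L^σ.  The right action xα is written α ⟨$⟩ʳ x.
O^ : ∀ {n} → LatinSquare n → Paratopism₁₂ n → Pred (Triple n) 0ℓ
O^ L ⟨ α , β , γ ⨾12⟩ t =
  ∃[ x ] ∃[ y ] ∃[ z ] (O L (x , y , z) × t ≡ (β ⟨$⟩ʳ y , α ⟨$⟩ʳ x , γ ⟨$⟩ʳ z))

IsAutoparatopism : ∀ {n} → Paratopism₁₂ n → LatinSquare n → Set
IsAutoparatopism σ L = ∀ t → O^ L σ t ⇔ O L t

Par : (n : ℕ) → Pred (Paratopism₁₂ n) 0ℓ
Par n σ = ∃[ L ] IsAutoparatopism σ L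

_≟ˢ_ : ∀ {n} → DecidableEquality (Subset n)
_≟ˢ_ = ≡-dec Bool._≟_

pow : ∀ {n} → Permutation′ n → ℕ → Fin n → Fin n
pow π k x = fold x (π ⟨$⟩ʳ_) k

-- A cycle is represented by the set of points it moves around, a fixed point
-- giving a singleton; its length is the size of that set.  Exponents below n
-- already reach the whole cycle: see ∈-cycleOf.
cycleOf : ∀ {n} → Permutation′ n → Fin n → Subset n
cycleOf {n} π x = tabulate λ y → does (any? {n = n} λ k → pow π (toℕ k) x ≟ y)

cycles : ∀ {n} → Permutation′ n → List (Subset n)
cycles {n} π = deduplicate _≟ˢ_ (map (cycleOf π) (allFin n))

o : ∀ {n} → Subset n → ℕ
o C = ∣ C ∣

#cyclesOfLength : ∀ {n} → ℕ → Permutation′ n → ℕ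
#cyclesOfLength d π = length (filter (λ C → o C ℕ.≟ d) (cycles π))

#fixedPoints : ∀ {n} → Permutation′ n → ℕ
#fixedPoints {n} π = length (filter (λ x → (π ⟨$⟩ʳ x) ≟ x) (allFin n))

module _ {n : ℕ} (β : Permutation′ n) (d : ℕ) where

  Cond-i Cond-ii Cond-iii : Pred (Subset n) 0ℓ
  Cond-i   C = Odd (o C) × o C ∣ d
  Cond-ii  C = ¬ Any (λ C′ → 1 < o C′ × o C′ < d × lcm (o C) (o C′) ≡ d) (cycles β)
  Cond-iii C = Odd (#fixedPoints β) → o C < d

  InΓ : Pred (Subset n) 0ℓ
  InΓ C = Cond-i C × Cond-ii C × Cond-iii C

  inΓ? : Decidable InΓ
  inΓ? C =
    (odd? (o C) ×-dec (o C ∣? d))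
      ×-dec ¬? (Any.any? (λ C′ → (1 ℕ.<? o C′) ×-dec (o C′ ℕ.<? d) ×-dec (lcm (o C) (o C′) ℕ.≟ d)) (cycles β))
      ×-dec (odd? (#fixedPoints β) →-dec (o C ℕ.<? d))

Γ : ∀ {n} (β γ : Permutation′ n) (d : ℕ) → List (Subset n)
Γ β γ d = filter (inΓ? β d) (cycles γ)

-- The list `cycles π` enumerates, without repetition, exactly the sets
-- { xπᵏ : k ∈ ℕ }.

IsCycle : ∀ {n} → Permutation′ n → Pred (Subset n) 0ℓ
IsCycle π C = ∃[ x ] (∀ y → y ∈ˢ C ⇔ (∃[ k ] pow π k x ≡ y))

private
  module _ {n : ℕ} (π : Permutation′ n) where

    inj : ∀ {x y} → π ⟨$⟩ʳ x ≡ π ⟨$⟩ʳ y → x ≡ y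
    inj {x} {y} e = trans (sym (inverseˡ π)) (trans (cong (π ⟨$⟩ˡ_) e) (inverseˡ π))

    pow-inj : ∀ k {x y} → pow π k x ≡ pow π k y → x ≡ y
    pow-inj zero    e = e
    pow-inj (suc k) e = pow-inj k (inj e)

    period : ∀ x → ∃[ p ] (0 < p × p ≤ n × pow π p x ≡ x)
    period x with pigeonhole (ℕ.n<1+n n) (λ k → pow π (toℕ k) x)
    ... | i , j , i<j , e =
      toℕ j ∸ toℕ i , ℕ.m<n⇒0<n∸m i<j , ℕ.≤-trans (ℕ.m∸n≤m (toℕ j) (toℕ i)) (toℕ≤pred[n] j) ,
      pow-inj (toℕ i) (trans (sym (fold-+ x (π ⟨$⟩ʳ_) (toℕ i)))
        (trans (cong (λ m → pow π m x) (ℕ.m+[n∸m]≡n (ℕ.<⇒≤ i<j))) (sym e)))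

    pow-multiple : ∀ {x} p q → pow π p x ≡ x → pow π (q * p) x ≡ x
    pow-multiple p zero    e = refl
    pow-multiple {x} p (suc q) e =
      trans (fold-+ x (π ⟨$⟩ʳ_) p) (trans (cong (pow π p) (pow-multiple p q e)) e)

    bounded : ∀ x k → ∃[ j ] (j < n × pow π j x ≡ pow π k x)
    bounded x k with period x
    ... | p , 0<p , p≤n , e = k % p , ℕ.<-≤-trans (m%n<n k p) p≤n ,
        sym (trans (cong (λ m → pow π m x) (m≡m%n+[m/n]*n k p))
          (trans (fold-+ x (π ⟨$⟩ʳ_) (k % p)) (cong (pow π (k % p)) (pow-multiple p (k / p) e))))
      where instance
        p≢0 : NonZero p
        p≢0 = >-nonZero 0<p

  does⇒ : ∀ {A : Set} (a? : Dec A) → does a? ≡ true → A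
  does⇒ (yes a) _ = a

  ⇒does : ∀ {A : Set} (a? : Dec A) → A → does a? ≡ true
  ⇒does (yes _) _ = refl
  ⇒does (no ¬a) a = ⊥-elim (¬a a)

  bool-ext : ∀ {a b} → (a ≡ true → b ≡ true) → (b ≡ true → a ≡ true) → a ≡ b
  bool-ext {true}         f g = sym (f refl)
  bool-ext {_}     {true} f g = g refl
  bool-ext {false} {false} f g = refl

  subset-ext : ∀ {n} {C D : Subset n} → (∀ y → y ∈ˢ C → y ∈ˢ D) → (∀ y → y ∈ˢ D → y ∈ˢ C) → C ≡ D
  subset-ext {C = C} {D} f g = trans (sym (tabulate∘lookup C)) (trans (tabulate-cong λ y →
    bool-ext (λ e → []=⇒lookup (f y (lookup⇒[]= y C e))) (λ e → []=⇒lookup (g y (lookup⇒[]= y D e))))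
    (tabulate∘lookup D))

∈-cycleOf : ∀ {n} (π : Permutation′ n) x y → y ∈ˢ cycleOf π x ⇔ (∃[ k ] pow π k x ≡ y)
∈-cycleOf {n} π x y = mk⇔ to from
  where
  f? : ∀ y → Dec (∃ λ (k : Fin n) → pow π (toℕ k) x ≡ y)
  f? y = any? λ k → pow π (toℕ k) x ≟ y

  to : y ∈ˢ cycleOf π x → ∃[ k ] pow π k x ≡ y
  to y∈ with does⇒ (f? y) (trans (sym (lookup∘tabulate (λ y → does (f? y)) y)) ([]=⇒lookup y∈))
  ... | k , e = toℕ k , e

  from : (∃[ k ] pow π k x ≡ y) → y ∈ˢ cycleOf π x
  from (k , e) with bounded π x k
  ... | j , j<n , e′ = lookup⇒[]= y _ (trans (lookup∘tabulate (λ y → does (f? y)) y)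
    (⇒does (f? y) (fromℕ< j<n , trans (cong (λ m → pow π m x) (toℕ-fromℕ< j<n)) (trans e′ e))))

∈-cycles : ∀ {n} (π : Permutation′ n) C → C ∈ cycles π ⇔ IsCycle π C
∈-cycles {n} π C = mk⇔ to from
  where
  to : C ∈ cycles π → IsCycle π C
  to C∈ with ∈-map⁻ (cycleOf π) (∈-deduplicate⁻ _≟ˢ_ (map (cycleOf π) (allFin n)) C∈)
  ... | x , _ , refl = x , ∈-cycleOf π x

  from : IsCycle π C → C ∈ cycles π
  from (x , h) = subst (_∈ cycles π)
    (subset-ext (λ y y∈ → Equivalence.from (h y) (Equivalence.to (∈-cycleOf π x y) y∈))
                (λ y y∈ → Equivalence.from (∈-cycleOf π x y) (Equivalence.to (h y) y∈)))
    (∈-deduplicate⁺ _≟ˢ_ (∈-map⁺ (cycleOf π) (∈-allFin x)))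

cycles-unique : ∀ {n} (π : Permutation′ n) → Unique (cycles π)
cycles-unique {n} π = DecUnique.deduplicate-! _≟ˢ_ (map (cycleOf π) (allFin n))

{-# OPTIONS --safe #-}
module Submission where

-- Let T(x, y) = (yβ, x) on cells; the autoparatopism says that T acts on
-- symbols as γ, and T² acts as β on rows and on columns.  For C ∈ Γ with
-- c = o(C), let X be the set of cells with symbol in C whose row lies in a
-- β-cycle of length l with lcm(l, c) = d.  T preserves X, and T²ᵏ fixes a cell
-- of X exactly when d ∣ k.  By (ii) l is 1 or d, and l = 1 forces c = d, so
-- |X| = c(rd + f) if c = d and |X| = crd otherwise, where f is the number of
-- fixed points of β.  If Tᵈ moved every cell of X, all T-orbits in X would have
-- length 2d, and 2d ∣ |X| contradicts the parity of r, c and, by (iii), f.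
-- So Tᵈ fixes some cell of X.  This is impossible for even d = 2k, as d ∤ k; for
-- d = 2k + 1 the cell is (x, xβᵏ) with x in a d-cycle of β.  The γ-cycle of the
-- symbol in (x, xβᵏ) depends only on the β-cycle of x, whence |Γ| ≤ r.

open import Defs
open import Data.Bool using (true; false)
open import Data.Fin using (Fin; toℕ; zero; suc)
open import Data.Fin.Permutation using (Permutation′; id; _⟨$⟩ʳ_; _⟨$⟩ˡ_; inverseˡ)
import Data.Fin.Properties as Fin
open import Data.Fin.Subset using (Subset; ∣_∣) renaming (_∈_ to _∈ˢ_)
import Data.Fin.Subset.Properties as Subset
open import Data.List using (List; []; _∷_; _++_; length; map; filter; allFin; applyUpTo; cartesianProductWith)
open import Data.List.Membership.Propositional using (_∈_; _∉_; find; lose)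
open import Data.List.Membership.Propositional.Properties
open import Data.List.Properties using (length-map; length-++; length-++-sucʳ; length-applyUpTo)
open import Data.List.Relation.Binary.Subset.Propositional using (_⊆_)
open import Data.List.Relation.Unary.All as All using ([]; _∷_)
open import Data.List.Relation.Unary.AllPairs using ([]; _∷_)
open import Data.List.Relation.Unary.Any as Any using (here; there)
open import Data.List.Relation.Unary.Unique.Propositional using (Unique)
import Data.List.Relation.Unary.Unique.Propositional.Properties as Unique
open import Data.Nat using (ℕ; zero; suc; pred; _+_; _*_; _∸_; _<_; _≤_; z≤n; s≤s; z<s; NonZero; >-nonZero)
open import Data.Nat.Divisibility
open import Data.Nat.DivMod using (_%_; _/_; m≡m%n+[m/n]*n; m%n<n)
open import Data.Nat.GeneralisedArithmetic using (fold; fold-+)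
open import Data.Nat.Induction using (<-wellFounded)
open import Data.Nat.LCM using (lcm; lcm-least; lcm-comm; m∣lcm[m,n]; n∣lcm[m,n])
open import Data.Nat.Primality using (euclidsLemma; prime[2])
import Data.Nat.Properties as ℕ
open import Data.Product using (_×_; _,_; proj₁; proj₂; ∃-syntax)
open import Data.Product.Properties using (≡-dec)
open import Data.Sum using (_⊎_; inj₁; inj₂)
open import Data.Vec using ([]; _∷_; here; there)
open import Function using (_⇔_; mk⇔; _∘_; Equivalence)
open import Induction.WellFounded using (Acc; acc)
open import Level using (Level)
open import Relation.Binary using (DecidableEquality)
open import Relation.Binary.PropositionalEquality using (_≡_; _≢_; refl; sym; trans; cong; cong₂; subst)
open import Relation.Nullary using (¬_; yes; no; ¬?; contradiction; _×-dec_)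
open import Relation.Nullary.Decidable using (decidable-stable)
open import Relation.Unary using (Pred; Decidable)

open Equivalence using (to; from)

private variable
  a p : Level
  A B : Set a

-- Lengths of lists

-- Induction on `xs`: a partner `y` of the head is deleted from `ys`, and injectivity keeps the
-- partners of the tail away from that occurrence. A relation replaces a function because partners
-- will come from existential statements, with no canonical choice.
injectiveRel⇒length≤ : ∀ {r} {R : A → B → Set r} {xs : List A} {ys : List B} → Unique xs →
  (∀ {x x′ y} → x ∈ xs → x′ ∈ xs → R x y → R x′ y → x ≡ x′) →
  (∀ {x} → x ∈ xs → ∃[ y ] (y ∈ ys × R x y)) → length xs ≤ length ys
injectiveRel⇒length≤ [] _ _ = z≤n
injectiveRel⇒length≤ {R = R} {xs = x ∷ xs} (x∉ ∷ xs!) inj image with image (here refl)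
... | y , y∈ , Rxy with ∈-∃++ y∈
...   | as , bs , refl = subst (suc (length xs) ≤_) (sym (length-++-sucʳ as y bs))
  (s≤s (injectiveRel⇒length≤ xs! (λ w∈ w′∈ → inj (there w∈) (there w′∈)) image′))
  where
  image′ : ∀ {w} → w ∈ xs → ∃[ y′ ] (y′ ∈ as ++ bs × R w y′)
  image′ w∈ with image (there w∈)
  ... | y′ , y′∈ , Rwy′ with ∈-++⁻ as y′∈
  ...   | inj₁ y′∈as         = y′ , ∈-++⁺ˡ y′∈as , Rwy′
  ...   | inj₂ (here refl)   = contradiction (inj (here refl) (there w∈) Rxy Rwy′) (All.lookup x∉ w∈)
  ...   | inj₂ (there y′∈bs) = y′ , ∈-++⁺ʳ as y′∈bs , Rwy′

unique∧⊆⇒length≤ : {xs ys : List A} → Unique xs → xs ⊆ ys → length xs ≤ length ys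
unique∧⊆⇒length≤ xs! xs⊆ys =
  injectiveRel⇒length≤ xs! (λ _ _ e e′ → trans e (sym e′)) (λ x∈ → _ , xs⊆ys x∈ , refl)

unique∧set⇒length≡ : {xs ys : List A} → Unique xs → Unique ys → xs ⊆ ys → ys ⊆ xs → length xs ≡ length ys
unique∧set⇒length≡ xs! ys! xs⊆ys ys⊆xs =
  ℕ.≤-antisym (unique∧⊆⇒length≤ xs! xs⊆ys) (unique∧⊆⇒length≤ ys! ys⊆xs)

length-filter+filter-¬ : {P : Pred A p} (P? : Decidable P) (xs : List A) →
  length (filter P? xs) + length (filter (¬? ∘ P?) xs) ≡ length xs
length-filter+filter-¬ P? []       = refl
length-filter+filter-¬ P? (x ∷ xs) with P? x
... | yes _ = cong suc (length-filter+filter-¬ P? xs)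
... | no  _ = trans (ℕ.+-suc _ _) (cong suc (length-filter+filter-¬ P? xs))

length-cartesianProductWith : ∀ {C : Set} (f : A → B → C) xs ys →
  length (cartesianProductWith f xs ys) ≡ length xs * length ys
length-cartesianProductWith f []       ys = refl
length-cartesianProductWith f (x ∷ xs) ys = trans (length-++ (map (f x) ys))
  (cong₂ _+_ (length-map (f x) ys) (length-cartesianProductWith f xs ys))

-- Induction on `ys`: the fibre over the head contributes `k`, and everything outside it maps into
-- the tail.
length-fibres : (_≟_ : DecidableEquality B) (g : A → B) (k : ℕ) (xs : List A) (ys : List B) →
  Unique xs → Unique ys → (∀ {x} → x ∈ xs → g x ∈ ys) →
  (∀ {y} → y ∈ ys → length (filter (λ x → g x ≟ y) xs) ≡ k) →
  length xs ≡ length ys * k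
length-fibres _≟_ g k []       []       _   _   _   _     = refl
length-fibres _≟_ g k (x ∷ xs) []       _   _   g∈  _     with () ← g∈ (here refl)
length-fibres {A = A} _≟_ g k xs       (y ∷ ys) xs! (y∉ ∷ ys!) g∈  fibre =
  trans (sym (length-filter+filter-¬ (λ x → g x ≟ y) xs))
    (cong₂ _+_ (fibre (here refl)) (length-fibres _≟_ g k rest ys rest! ys! g∈ys fibre′))
  where
  rest : List A
  rest = filter (λ x → ¬? (g x ≟ y)) xs

  rest! : Unique rest
  rest! = Unique.filter⁺ (λ x → ¬? (g x ≟ y)) xs!

  g∈ys : ∀ {x} → x ∈ rest → g x ∈ ys
  g∈ys x∈ with ∈-filter⁻ (λ x → ¬? (g x ≟ y)) {xs = xs} x∈
  ... | x∈xs , gx≢y with g∈ x∈xs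
  ...   | here gx≡y  = contradiction gx≡y gx≢y
  ...   | there gx∈ = gx∈

  fibre′ : ∀ {y′} → y′ ∈ ys → length (filter (λ x → g x ≟ y′) rest) ≡ k
  -- Since `ys` has no repetition, `y′` differs from `y`, so discarding the fibre over `y` leaves
  -- the fibre over `y′` unchanged.
  fibre′ {y′} y′∈ = trans
    (unique∧set⇒length≡ (Unique.filter⁺ _ rest!) (Unique.filter⁺ _ xs!)
      (λ w∈ → let w∈rest , e = ∈-filter⁻ (λ x → g x ≟ y′) {xs = rest} w∈
              in ∈-filter⁺ _ (proj₁ (∈-filter⁻ (λ x → ¬? (g x ≟ y)) {xs = xs} w∈rest)) e)
      (λ w∈ → let w∈xs , e = ∈-filter⁻ (λ x → g x ≟ y′) {xs = xs} w∈
              in ∈-filter⁺ _ (∈-filter⁺ _ w∈xs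
                   (λ gw≡y → All.lookup y∉ y′∈ (trans (sym gw≡y) e))) e))
    (fibre (there y′∈))

-- Iteration and periods

iter : (A → A) → ℕ → A → A
iter f k x = fold x f k

iter-shift : ∀ (f : A → A) k x → iter f k (f x) ≡ f (iter f k x)
iter-shift f zero    x = refl
iter-shift f (suc k) x = cong f (iter-shift f k x)

iter-multiple : ∀ (f : A → A) {x} q k → iter f k x ≡ x → iter f (q * k) x ≡ x
iter-multiple f zero    k e = refl
iter-multiple f {x} (suc q) k e = trans (fold-+ x f k) (trans (cong (iter f k) (iter-multiple f q k e)) e)

iter-injective : ∀ {f : A → A} → (∀ {x y} → f x ≡ f y → x ≡ y) →
  ∀ k {x y} → iter f k x ≡ iter f k y → x ≡ y
iter-injective inj zero    e = e
iter-injective inj (suc k) e = iter-injective inj k (inj e)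

-- The return times are exactly the multiples of `N`, so a nonzero `N` is the least period and the
-- size of the orbit.
HasPeriod : (A → A) → ℕ → A → Set _
HasPeriod f N x = ∀ k → iter f k x ≡ x ⇔ N ∣ k

module _ {f : A → A} {N : ℕ} .{{_ : NonZero N}} {x : A} (per : HasPeriod f N x) where

  orbit : List A
  orbit = applyUpTo (λ i → iter f i x) N

  iter-% : ∀ k → iter f k x ≡ iter f (k % N) x
  iter-% k = trans (cong (λ m → iter f m x) (m≡m%n+[m/n]*n k N))
    (trans (fold-+ x f (k % N)) (cong (iter f (k % N)) (from (per _) (n∣m*n (k / N)))))

  ∈-orbit : ∀ k → iter f k x ∈ orbit
  ∈-orbit k = subst (_∈ orbit) (sym (iter-% k)) (∈-applyUpTo⁺ (λ i → iter f i x) (m%n<n k N))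

  orbit⁻ : ∀ {y} → y ∈ orbit → ∃[ k ] y ≡ iter f k x
  orbit⁻ y∈ with ∈-applyUpTo⁻ (λ i → iter f i x) y∈
  ... | i , _ , e = i , e

  -- As `f` cannot be cancelled, a coincidence of the iterates `i < j` is pushed forward by `N ∸ i`
  -- steps, to a return of `x` after `N + (j ∸ i)` steps. Then `N` divides `j ∸ i`, which lies
  -- strictly between 0 and `N`.
  orbit! : Unique orbit
  orbit! = Unique.applyUpTo⁺₁ _ N λ {i} {j} i<j j<N e →
    let i≤N = ℕ.<⇒≤ (ℕ.<-trans i<j j<N)
        N∸i+j = trans (cong (N ∸ i +_) (sym (ℕ.m+[n∸m]≡n (ℕ.<⇒≤ i<j))))
                  (trans (sym (ℕ.+-assoc (N ∸ i) i (j ∸ i))) (cong (_+ (j ∸ i)) (ℕ.m∸n+n≡m i≤N)))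
        fixed : iter f (N + (j ∸ i)) x ≡ x
        fixed = trans (cong (λ m → iter f m x) (sym N∸i+j))
          (trans (fold-+ x f (N ∸ i)) (trans (cong (iter f (N ∸ i)) (sym e))
            (trans (sym (fold-+ x f (N ∸ i))) (trans (cong (λ m → iter f m x) (ℕ.m∸n+n≡m i≤N))
              (from (per N) ∣-refl)))))
        N∣j∸i = ∣m+n∣m⇒∣n (to (per _) fixed) ∣-refl
    in >⇒∤ {{>-nonZero (ℕ.m<n⇒0<n∸m i<j)}} (ℕ.≤-<-trans (ℕ.m∸n≤m j i) j<N) N∣j∸i

  iter-return : ∀ k → ∃[ m ] iter f m (iter f k x) ≡ x
  -- Together with the first `k` steps this makes `k * N`, a multiple of the period, without
  -- comparing `k` with `N`.
  iter-return k = k * pred N , trans (sym (fold-+ x f (k * pred N)))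
    (from (per _) (subst (N ∣_) k*N≡ (n∣m*n k)))
    where
    k*N≡ : k * N ≡ k * pred N + k
    k*N≡ = trans (cong (k *_) (sym (ℕ.suc-pred N))) (trans (ℕ.*-suc k (pred N)) (ℕ.+-comm k _))

-- Descent through positive return times ends at one with none below it; a nonzero remainder of
-- another return time modulo it would be a smaller one.
leastPeriod : DecidableEquality A → (f : A → A) (x : A) → ∀ k → 0 < k → iter f k x ≡ x →
  ∃[ N ] (0 < N × HasPeriod f N x)
leastPeriod _≟_ f x k = go k (<-wellFounded k)
  where
  go : ∀ k → Acc _<_ k → 0 < k → iter f k x ≡ x → ∃[ N ] (0 < N × HasPeriod f N x)
  go k (acc rec) 0<k e with ℕ.anyUpTo? (λ j → (0 ℕ.<? j) ×-dec (iter f j x ≟ x)) k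
  ... | yes (j , j<k , 0<j , e′) = go j (rec j<k) 0<j e′
  ... | no none = k , 0<k , λ m → mk⇔ (dvd m) λ { (divides q refl) → iter-multiple f q k e }
    where
    instance
      k≢0 : NonZero k
      k≢0 = >-nonZero 0<k

    dvd : ∀ m → iter f m x ≡ x → k ∣ m
    dvd m e′ with m % k in eq
    ... | zero  = m%n≡0⇒n∣m m k eq
    ... | suc j = contradiction
      (suc j , subst (_< k) eq (m%n<n m k) , z<s ,
        trans (cong (iter f (suc j)) (sym (iter-multiple f (m / k) k e)))
          (trans (sym (fold-+ x f (suc j))) (trans (cong (λ i → iter f i x)
            (sym (subst (λ s → m ≡ s + m / k * k) eq (m≡m%n+[m/n]*n m k)))) e′)))
      none

-- One whole orbit, of size `N`, is split off at a time; what is left is shorter and again closed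
-- under `f`.
commonPeriod∣length : DecidableEquality A → (f : A → A) (N : ℕ) .{{_ : NonZero N}} (xs : List A) → Unique xs →
  (∀ {x} → x ∈ xs → f x ∈ xs) → (∀ {x} → x ∈ xs → HasPeriod f N x) → N ∣ length xs
commonPeriod∣length {A = A} _≟_ f N@(suc M) xs = go xs (<-wellFounded (length xs))
  where
  go : ∀ xs → Acc _<_ (length xs) → Unique xs →
    (∀ {x} → x ∈ xs → f x ∈ xs) → (∀ {x} → x ∈ xs → HasPeriod f N x) → N ∣ length xs
  go []          _         _   _      _   = N ∣0
  go xs@(x ∷ _) (acc rec) xs! closed per =
    subst (N ∣_) split (∣m∣n⇒∣m+n ∣-refl (go outside (rec shorter) (Unique.filter⁺ (¬? ∘ in?) xs!) outside-closed
      (per ∘ proj₁ ∘ outside⁻)))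
    where
    orb : List A
    orb = orbit (per (here refl))

    in? : Decidable (_∈ orb)
    in? w = Any.any? (w ≟_) orb

    outside : List A
    outside = filter (¬? ∘ in?) xs

    outside⁻ : ∀ {w} → w ∈ outside → w ∈ xs × w ∉ orb
    outside⁻ = ∈-filter⁻ (¬? ∘ in?) {xs = xs}

    iter-closed : ∀ k → iter f k x ∈ xs
    iter-closed zero    = here refl
    iter-closed (suc k) = closed (iter-closed k)

    length-inside : length (filter in? xs) ≡ N
    length-inside = trans
      (unique∧set⇒length≡ (Unique.filter⁺ in? xs!) (orbit! (per (here refl)))
        (λ w∈ → proj₂ (∈-filter⁻ in? {xs = xs} w∈))
        (λ w∈ → let k , e = orbit⁻ (per (here refl)) w∈
                in ∈-filter⁺ in? (subst (_∈ xs) (sym e) (iter-closed k)) w∈))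
      (length-applyUpTo (λ i → iter f i x) N)

    split : N + length outside ≡ length xs
    split = trans (cong (_+ length outside) (sym length-inside)) (length-filter+filter-¬ in? xs)

    shorter : length outside < length xs
    shorter = subst (length outside <_) split (ℕ.m<n+m (length outside) z<s)

    outside-closed : ∀ {w} → w ∈ outside → f w ∈ outside
    outside-closed {w} w∈ = ∈-filter⁺ (¬? ∘ in?) (closed w∈xs) fw∉
      where
      w∈xs : w ∈ xs
      w∈xs = proj₁ (outside⁻ w∈)

      fw∉ : f w ∉ orb
      fw∉ fw∈ with orbit⁻ (per (here refl)) fw∈
      -- If `f w` were on the orbit of `x`, then `M` further steps would put `w` itself there,
      -- because `N = suc M` steps bring `w` back.
      ... | i , e = proj₂ (outside⁻ w∈) (subst (_∈ orb)
        (trans (fold-+ x f M) (trans (cong (iter f M) (sym e))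
          (trans (iter-shift f M w) (from (per w∈xs N) ∣-refl))))
        (∈-orbit (per (here refl)) (M + i)))

-- Cycles of permutations

elements : ∀ {n} → Subset n → List (Fin n)
elements []          = []
elements (true  ∷ C) = zero ∷ map suc (elements C)
elements (false ∷ C) = map suc (elements C)

length-elements : ∀ {n} (C : Subset n) → length (elements C) ≡ ∣ C ∣
length-elements []          = refl
length-elements (true  ∷ C) = cong suc (trans (length-map suc (elements C)) (length-elements C))
length-elements (false ∷ C) = trans (length-map suc (elements C)) (length-elements C)

∈-elements⁺ : ∀ {n} {C : Subset n} {x} → x ∈ˢ C → x ∈ elements C
∈-elements⁺ {C = true  ∷ C} here       = here refl
∈-elements⁺ {C = true  ∷ C} (there x∈) = there (∈-map⁺ suc (∈-elements⁺ x∈))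
∈-elements⁺ {C = false ∷ C} (there x∈) = ∈-map⁺ suc (∈-elements⁺ x∈)

∈-elements⁻ : ∀ {n} (C : Subset n) {x} → x ∈ elements C → x ∈ˢ C
∈-elements⁻ (true  ∷ C) (here refl) = here
∈-elements⁻ (true  ∷ C) (there x∈) with ∈-map⁻ suc x∈
... | _ , y∈ , refl = there (∈-elements⁻ C y∈)
∈-elements⁻ (false ∷ C) x∈ with ∈-map⁻ suc x∈
... | _ , y∈ , refl = there (∈-elements⁻ C y∈)

elements! : ∀ {n} (C : Subset n) → Unique (elements C)
elements! []          = []
elements! (true  ∷ C) =
  All.tabulate (λ x∈ e → zero∉ (subst (_∈ map suc (elements C)) (sym e) x∈)) ∷
  Unique.map⁺ Fin.suc-injective (elements! C)
  where
  zero∉ : zero ∉ map suc (elements C)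
  zero∉ 0∈ with ∈-map⁻ suc 0∈
  ... | _ , _ , ()
elements! (false ∷ C) = Unique.map⁺ Fin.suc-injective (elements! C)

module _ {n : ℕ} (π : Permutation′ n) where

  perm-injective : ∀ {x y} → π ⟨$⟩ʳ x ≡ π ⟨$⟩ʳ y → x ≡ y
  perm-injective e = trans (sym (inverseˡ π)) (trans (cong (π ⟨$⟩ˡ_) e) (inverseˡ π))

  len : Fin n → ℕ
  len x = o (cycleOf π x)

  private
    period : ∀ x → ∃[ N ] (0 < N × HasPeriod (π ⟨$⟩ʳ_) N x)
    period x with Fin.pigeonhole (ℕ.n<1+n n) (λ k → pow π (toℕ k) x)
    ... | i , j , i<j , e = leastPeriod Fin._≟_ (π ⟨$⟩ʳ_) x (toℕ j ∸ toℕ i) (ℕ.m<n⇒0<n∸m i<j)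
      (sym (iter-injective perm-injective (toℕ i)
        (trans e (trans (cong (λ m → pow π m x) (sym (ℕ.m+[n∸m]≡n (ℕ.<⇒≤ i<j)))) (fold-+ x _ (toℕ i))))))

    -- The cycle and the orbit, both listed without repetition, have the same members. This passes
    -- from the size of a cycle as a set to return times.
    len≡ : ∀ x → len x ≡ proj₁ (period x)
    len≡ x with period x
    ... | N , 0<N , per = trans (sym (length-elements (cycleOf π x)))
      (trans (unique∧set⇒length≡ (elements! (cycleOf π x)) (orbit! per)
        (λ {y} y∈ → let k , e = to (∈-cycleOf π x y) (∈-elements⁻ (cycleOf π x) y∈)
                    in subst (_∈ orbit per) e (∈-orbit per k))
        (λ {y} y∈ → let k , e = orbit⁻ per y∈
                    in ∈-elements⁺ (from (∈-cycleOf π x y) (k , sym e))))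
      (length-applyUpTo _ N))
      where instance
        N≢0 : NonZero N
        N≢0 = >-nonZero 0<N

  0<len : ∀ x → 0 < len x
  0<len x = subst (0 <_) (sym (len≡ x)) (proj₁ (proj₂ (period x)))

  len-period : ∀ x → HasPeriod (π ⟨$⟩ʳ_) (len x) x
  len-period x = subst (λ N → HasPeriod (π ⟨$⟩ʳ_) N x) (sym (len≡ x)) (proj₂ (proj₂ (period x)))

  cycleOf-self : ∀ x → x ∈ˢ cycleOf π x
  cycleOf-self x = from (∈-cycleOf π x x) (0 , refl)

  cycleOf-pow : ∀ k x → cycleOf π (pow π k x) ≡ cycleOf π x
  cycleOf-pow k x = Subset.⊆-antisym
    (λ {w} w∈ → let j , e = to (∈-cycleOf π _ w) w∈
                in from (∈-cycleOf π x w) (j + k , trans (fold-+ x _ j) e))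
    -- This inclusion needs a way back from `pow π k x` to `x`, which periodicity supplies.
    (λ {w} w∈ → let j , e  = to (∈-cycleOf π x w) w∈
                    m , e′ = iter-return {{>-nonZero (0<len x)}} (len-period x) k
                in from (∈-cycleOf π _ w) (j + m , trans (fold-+ _ _ j) (trans (cong (pow π j) e′) e)))

  ∈⇒cycleOf≡ : ∀ {x y} → y ∈ˢ cycleOf π x → cycleOf π y ≡ cycleOf π x
  ∈⇒cycleOf≡ {x} {y} y∈ with to (∈-cycleOf π x y) y∈
  ... | k , refl = cycleOf-pow k x

  cycleOf∈cycles : ∀ x → cycleOf π x ∈ cycles π
  cycleOf∈cycles x = from (∈-cycles π _) (x , ∈-cycleOf π x)

  ∈cycles⇒cycleOf : ∀ {C} → C ∈ cycles π → ∃[ x ] C ≡ cycleOf π x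
  ∈cycles⇒cycleOf {C} C∈ with to (∈-cycles π C) C∈
  ... | x , h = x , Subset.⊆-antisym
    (λ {y} y∈ → from (∈-cycleOf π x y) (to (h y) y∈))
    (λ {y} y∈ → from (h y) (to (∈-cycleOf π x y) y∈))

  pointsOfLength : ℕ → List (Fin n)
  pointsOfLength d = filter (λ x → len x ℕ.≟ d) (allFin n)

  pointsOfLength! : ∀ d → Unique (pointsOfLength d)
  pointsOfLength! d = Unique.filter⁺ (λ x → len x ℕ.≟ d) (Unique.allFin⁺ n)

  ∈-pointsOfLength : ∀ {d x} → x ∈ pointsOfLength d ⇔ len x ≡ d
  ∈-pointsOfLength {d} = mk⇔ (λ x∈ → proj₂ (∈-filter⁻ (λ x → len x ℕ.≟ d) {xs = allFin n} x∈))
    (∈-filter⁺ (λ x → len x ℕ.≟ d) (∈-allFin _))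

  -- The fibres of `cycleOf` over the cycles of length `d` are these cycles themselves, with `d`
  -- points each.
  length-pointsOfLength : ∀ d → length (pointsOfLength d) ≡ #cyclesOfLength d π * d
  length-pointsOfLength d = length-fibres _≟ˢ_ (cycleOf π) d (pointsOfLength d) _
    (pointsOfLength! d) (Unique.filter⁺ _ (cycles-unique π))
    (λ x∈ → ∈-filter⁺ (λ C → o C ℕ.≟ d) (cycleOf∈cycles _) (to ∈-pointsOfLength x∈)) fibre
    where
    fibre : ∀ {D} → D ∈ filter (λ C → o C ℕ.≟ d) (cycles π) →
      length (filter (λ x → cycleOf π x ≟ˢ D) (pointsOfLength d)) ≡ d
    fibre D∈ with ∈-filter⁻ (λ C → o C ℕ.≟ d) {xs = cycles π} D∈
    ... | D∈cyc , oD≡d with ∈cycles⇒cycleOf D∈cyc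
    ...   | x , refl = trans (unique∧set⇒length≡ (Unique.filter⁺ _ (pointsOfLength! d)) (elements! (cycleOf π x))
      (λ {w} w∈ → let _ , e = ∈-filter⁻ (λ x′ → cycleOf π x′ ≟ˢ cycleOf π x) {xs = pointsOfLength d} w∈
                  in ∈-elements⁺ (subst (w ∈ˢ_) e (cycleOf-self w)))
      (λ {w} w∈ → let e = ∈⇒cycleOf≡ (∈-elements⁻ (cycleOf π x) w∈)
                  in ∈-filter⁺ _ (from ∈-pointsOfLength (trans (cong o e) oD≡d)) e))
      (trans (length-elements (cycleOf π x)) oD≡d)

  length-pointsOfLength-1 : length (pointsOfLength 1) ≡ #fixedPoints π
  length-pointsOfLength-1 = unique∧set⇒length≡ (pointsOfLength! 1) (Unique.filter⁺ _ (Unique.allFin⁺ n))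
    (λ {x} x∈ → ∈-filter⁺ (λ x → (π ⟨$⟩ʳ x) Fin.≟ x) (∈-allFin x)
      (from (len-period x 1) (subst (_∣ 1) (sym (to ∈-pointsOfLength x∈)) ∣-refl)))
    (λ {x} x∈ → from ∈-pointsOfLength (∣1⇒≡1 (to (len-period x 1)
      (proj₂ (∈-filter⁻ (λ x → (π ⟨$⟩ʳ x) Fin.≟ x) {xs = allFin n} x∈)))))

-- Autoparatopisms acting on cells

odd*odd : ∀ {i j} → Odd i → Odd j → Odd (i * j)
odd*odd {i} {j} i-odd j-odd 2∣ij with euclidsLemma i j prime[2] 2∣ij
... | inj₁ 2∣i = i-odd 2∣i
... | inj₂ 2∣j = j-odd 2∣j

-- In `k * 2 ≡ q * c` with `c` odd, the prime 2 must divide `q` and can be cancelled.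
odd∣*2⇒∣ : ∀ {c k} → Odd c → c ∣ k * 2 → c ∣ k
odd∣*2⇒∣ {c} {k} c-odd (divides q k*2≡) with euclidsLemma q c prime[2] (divides k (sym k*2≡))
... | inj₂ 2∣c = contradiction 2∣c c-odd
... | inj₁ (divides q′ refl) = divides q′ (ℕ.*-cancelʳ-≡ k (q′ * c) 2
        (trans k*2≡ (trans (ℕ.*-assoc q′ 2 c) (trans (cong (q′ *_) (ℕ.*-comm 2 c)) (sym (ℕ.*-assoc q′ c 2))))))

odd⇒1+even : ∀ d → Odd d → ∃[ k ] d ≡ suc (k * 2)
odd⇒1+even zero          d-odd = contradiction (2 ∣0) d-odd
odd⇒1+even (suc zero)    d-odd = 0 , refl
odd⇒1+even (suc (suc d)) d-odd with odd⇒1+even d (d-odd ∘ ∣m∣n⇒∣m+n (∣-refl {2}))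
... | k , refl = suc k , refl

module _ {n : ℕ} (β γ : Permutation′ n) (L : LatinSquare n) (aut : IsAutoparatopism ⟨ id , β , γ ⨾12⟩ L) where

  Cell : Set
  Cell = Fin n × Fin n

  _≟ᶜ_ : DecidableEquality Cell
  _≟ᶜ_ = ≡-dec Fin._≟_ Fin._≟_

  symbol : Cell → Fin n
  symbol (x , y) = entry L x y

  row-injective : ∀ {x y y′} → entry L x y ≡ entry L x y′ → y ≡ y′
  row-injective {x} {y} {y′} e with rowLatin L x (entry L x y′)
  ... | _ , _ , uniq = trans (sym (uniq e)) (uniq refl)

  col : Fin n → Fin n → Fin n
  col x z = proj₁ (rowLatin L x z)

  entry-col : ∀ x z → entry L x (col x z) ≡ z
  entry-col x z = proj₁ (proj₂ (rowLatin L x z))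

  T : Cell → Cell
  T (x , y) = β ⟨$⟩ʳ y , x

  T-injective : ∀ {u v} → T u ≡ T v → u ≡ v
  T-injective e = cong₂ _,_ (cong proj₂ e) (perm-injective β (cong proj₁ e))

  symbol-T : ∀ u → symbol (T u) ≡ γ ⟨$⟩ʳ symbol u
  symbol-T (x , y) = to (aut _) (x , y , _ , refl , refl)

  symbol-iter : ∀ k u → symbol (iter T k u) ≡ pow γ k (symbol u)
  symbol-iter zero    u = refl
  symbol-iter (suc k) u = trans (symbol-T (iter T k u)) (cong (γ ⟨$⟩ʳ_) (symbol-iter k u))

  -- Two applications of `T` restore the order of the coordinates and apply β once to each. Writing
  -- the exponent as `k * 2` makes it unfold two steps at a time.
  iter-T-even : ∀ k x y → iter T (k * 2) (x , y) ≡ (pow β k x , pow β k y)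
  iter-T-even zero    x y = refl
  iter-T-even (suc k) x y = cong (T ∘ T) (iter-T-even k x y)

  module _ {d : ℕ} (1<d : 1 < d) where

    instance
      d≢0 : NonZero d
      d≢0 = >-nonZero (ℕ.<-trans z<s 1<d)

    -- Cells whose symbol lies in an odd cycle of γ

    module _ (C : Subset n) (C∈cycles : C ∈ cycles γ) (C-odd : Odd (o C)) where

      -- The period of T² at a cell with symbol in `C`, as `even-period` shows.
      ℓ : Cell → ℕ
      ℓ (x , _) = lcm (len β x) (o C)

      symbol-period : ∀ {z} → z ∈ˢ C → HasPeriod (γ ⟨$⟩ʳ_) (o C) z
      symbol-period {z} z∈ with ∈cycles⇒cycleOf γ C∈cycles
      ... | _ , refl = subst (λ D → HasPeriod (γ ⟨$⟩ʳ_) (o D) z) (∈⇒cycleOf≡ γ z∈) (len-period γ z)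

      γ-closed : ∀ {z} → z ∈ˢ C → γ ⟨$⟩ʳ z ∈ˢ C
      γ-closed {z} z∈ with ∈cycles⇒cycleOf γ C∈cycles
      ... | z₀ , refl with to (∈-cycleOf γ z₀ z) z∈
      ...   | k , refl = from (∈-cycleOf γ z₀ _) (suc k , refl)

      -- A cell is determined by its row and symbol, so T²ᵏ fixes it once it fixes
      -- both; γ²ᵏ fixes the symbol iff γᵏ does because o(C) is odd.
      even-period : ∀ {u} → symbol u ∈ˢ C → ∀ k → iter T (k * 2) u ≡ u ⇔ ℓ u ∣ k
      even-period {u@(x , y)} s∈ k = mk⇔ fwd bwd
        where
        symbol-even : symbol (iter T (k * 2) u) ≡ pow γ (k * 2) (symbol u)
        symbol-even = symbol-iter (k * 2) u

        fwd : iter T (k * 2) u ≡ u → ℓ u ∣ k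
        fwd e = lcm-least
          (to (len-period β x k) (cong proj₁ (trans (sym (iter-T-even k x y)) e)))
          (odd∣*2⇒∣ C-odd (to (symbol-period s∈ (k * 2)) (trans (sym symbol-even) (cong symbol e))))

        bwd : ℓ u ∣ k → iter T (k * 2) u ≡ u
        bwd ℓ∣k = trans (iter-T-even k x y) (cong₂ _,_ row≡ (row-injective (trans
            (cong symbol (trans (cong (_, pow β k y) (sym row≡)) (sym (iter-T-even k x y))))
            (trans symbol-even (from (symbol-period s∈ (k * 2))
              (∣m⇒∣m*n 2 (∣-trans (n∣lcm[m,n] (len β x) (o C)) ℓ∣k)))))))
          where
          row≡ : pow β k x ≡ x
          row≡ = from (len-period β x k) (∣-trans (m∣lcm[m,n] (len β x) (o C)) ℓ∣k)

      symbol-T∈ : ∀ {u} → symbol u ∈ˢ C → symbol (T u) ∈ˢ C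
      symbol-T∈ {u} s∈ = subst (_∈ˢ C) (sym (symbol-T u)) (γ-closed s∈)

      -- `ℓ` reads only the row, and `T` moves the column into its place, so the formula does not
      -- show the invariance. It holds because `T` is injective and commutes with its iterates: a
      -- cell and its image have the same even return times, so their values of `ℓ` divide each
      -- other.
      ℓ-T : ∀ {u} → symbol u ∈ˢ C → ℓ (T u) ≡ ℓ u
      ℓ-T {u} s∈ = ∣-antisym
        (to (even-period (symbol-T∈ s∈) (ℓ u))
          (trans (iter-shift T (ℓ u * 2) u) (cong T (from (even-period s∈ (ℓ u)) ∣-refl))))
        (to (even-period s∈ (ℓ (T u)))
          (T-injective (trans (sym (iter-shift T (ℓ (T u) * 2) u))
            (from (even-period (symbol-T∈ s∈) (ℓ (T u))) ∣-refl))))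

      rows : List (Fin n)
      rows = filter (λ x → lcm (len β x) (o C) ℕ.≟ d) (allFin n)

      rows! : Unique rows
      rows! = Unique.filter⁺ _ (Unique.allFin⁺ n)

      ∈-rows : ∀ {x} → x ∈ rows ⇔ lcm (len β x) (o C) ≡ d
      ∈-rows = mk⇔ (λ x∈ → proj₂ (∈-filter⁻ (λ x → lcm (len β x) (o C) ℕ.≟ d) {xs = allFin n} x∈))
        (∈-filter⁺ _ (∈-allFin _))

      -- The set X. Each row holds each symbol exactly once, so a cell can be given by its row and
      -- symbol, and the size becomes a product.
      cells : List Cell
      cells = cartesianProductWith (λ x z → x , col x z) rows (elements C)

      cells! : Unique cells
      cells! = Unique.cartesianProductWith⁺ (λ x z → x , col x z) inj rows! (elements! C)
        where
        inj : ∀ {w x y z} → (w , col w y) ≡ (x , col x z) → w ≡ x × y ≡ z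
        inj {w} {x} {y} {z} e = cong proj₁ e ,
          trans (sym (entry-col w y)) (trans (cong symbol e) (entry-col x z))

      length-cells : length cells ≡ length rows * o C
      length-cells = trans (length-cartesianProductWith _ rows (elements C))
        (cong (length rows *_) (length-elements C))

      ∈-cells : ∀ {u} → u ∈ cells ⇔ (symbol u ∈ˢ C × ℓ u ≡ d)
      ∈-cells = mk⇔ fwd bwd
        where
        fwd : ∀ {u} → u ∈ cells → symbol u ∈ˢ C × ℓ u ≡ d
        fwd u∈ with ∈-cartesianProductWith⁻ (λ x z → x , col x z) rows (elements C) u∈
        ... | x , z , x∈ , z∈ , refl = subst (_∈ˢ C) (sym (entry-col x z)) (∈-elements⁻ C z∈) , to ∈-rows x∈

        bwd : ∀ {u} → symbol u ∈ˢ C × ℓ u ≡ d → u ∈ cells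
        bwd {x , y} (s∈ , ℓ≡d) = subst (_∈ cells) (cong (x ,_) (row-injective (entry-col x _)))
          (∈-cartesianProductWith⁺ (λ x z → x , col x z) (from ∈-rows ℓ≡d) (∈-elements⁺ s∈))

      cells-closed : ∀ {u} → u ∈ cells → T u ∈ cells
      cells-closed u∈ with to ∈-cells u∈
      ... | s∈ , ℓ≡d = from ∈-cells (symbol-T∈ s∈ , trans (ℓ-T s∈) ℓ≡d)

      cells-even-period : ∀ {u} → u ∈ cells → ∀ k → iter T (k * 2) u ≡ u ⇔ d ∣ k
      cells-even-period {u} u∈ k with to ∈-cells u∈
      ... | s∈ , ℓ≡d = subst (λ m → iter T (k * 2) u ≡ u ⇔ m ∣ k) ℓ≡d (even-period s∈ k)

      -- A return after k steps is also one after 2k, so k is a multiple `q * d`. As T²ᵈ fixes the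
      -- cell, an odd `q` would make Tᵈ fix it too.
      cells-period : (∀ {u} → u ∈ cells → iter T d u ≢ u) → ∀ {u} → u ∈ cells → HasPeriod T (d * 2) u
      cells-period moved {u} u∈ k = mk⇔ fwd λ { (divides q refl) → iter-multiple T q (d * 2) T²ᵈ }
        where
        T²ᵈ : iter T (d * 2) u ≡ u
        T²ᵈ = from (cells-even-period u∈ d) ∣-refl

        fwd : iter T k u ≡ u → d * 2 ∣ k
        fwd e with to (cells-even-period u∈ k)
                     (trans (cong (λ m → iter T m u) (ℕ.*-comm k 2)) (iter-multiple T 2 k e))
        ... | divides q refl with 2 ∣? q
        ...   | yes (divides j refl) = divides j (trans (ℕ.*-assoc j 2 d) (cong (j *_) (ℕ.*-comm 2 d)))
        ...   | no q-odd with odd⇒1+even q q-odd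
        ...     | j , refl = contradiction (trans (cong (iter T d) (sym even-part)) (trans (sym (fold-+ u T d)) e))
                               (moved u∈)
          where
          even-part : iter T (j * 2 * d) u ≡ u
          even-part = trans (cong (λ m → iter T m u) (trans (ℕ.*-assoc j 2 d) (cong (j *_) (ℕ.*-comm 2 d))))
            (iter-multiple T j (d * 2) T²ᵈ)

      -- Parity count for a cycle in Γ

      module _ (C-inΓ : InΓ β d C) (r-odd : Odd (#cyclesOfLength d β)) where

        c∣d : o C ∣ d
        c∣d = proj₂ (proj₁ C-inΓ)

        -- The length divides `d`, so it cannot exceed `d`; (ii) excludes everything strictly
        -- between 1 and `d`.
        lcm-len≡d⇒ : ∀ x → lcm (len β x) (o C) ≡ d → len β x ≡ 1 ⊎ len β x ≡ d
        lcm-len≡d⇒ x e with 1 ℕ.<? len β x | len β x ℕ.<? d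
        ... | no 1≮len   | _        = inj₁ (ℕ.≤-antisym (ℕ.≮⇒≥ 1≮len) (0<len β x))
        ... | yes _      | no len≮d = inj₂ (ℕ.≤-antisym (∣⇒≤ (subst (len β x ∣_) e (m∣lcm[m,n] _ (o C)))) (ℕ.≮⇒≥ len≮d))
        ... | yes 1<len  | yes len<d = contradiction
          (Any.map (λ { refl → 1<len , len<d , trans (lcm-comm (o C) _) e }) (cycleOf∈cycles β x))
          (proj₁ (proj₂ C-inΓ))

        lcm[d,c]≡d : lcm d (o C) ≡ d
        lcm[d,c]≡d = ∣-antisym (lcm-least ∣-refl c∣d) (m∣lcm[m,n] d (o C))

        lcm[1,c]≡c : lcm 1 (o C) ≡ o C
        lcm[1,c]≡c = ∣-antisym (lcm-least (1∣ o C) ∣-refl) (n∣lcm[m,n] 1 (o C))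

        S⊆rows : pointsOfLength β d ⊆ rows
        S⊆rows x∈ = from ∈-rows (trans (cong (λ m → lcm m (o C)) (to (∈-pointsOfLength β) x∈)) lcm[d,c]≡d)

        length-rows-≢ : o C ≢ d → length rows ≡ #cyclesOfLength d β * d
        length-rows-≢ c≢d = trans (unique∧set⇒length≡ rows! (pointsOfLength! β d) rows⊆S S⊆rows) (length-pointsOfLength β d)
          where
          rows⊆S : rows ⊆ pointsOfLength β d
          rows⊆S {x} x∈ with lcm-len≡d⇒ x (to ∈-rows x∈)
          -- At a fixed point of β the lcm is `o C`, which differs from `d` here.
          ... | inj₁ len≡1 = contradiction
            (trans (sym lcm[1,c]≡c) (trans (cong (λ m → lcm m (o C)) (sym len≡1)) (to ∈-rows x∈))) c≢d
          ... | inj₂ len≡d = from (∈-pointsOfLength β) len≡d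

        -- Now the fixed points of β qualify as well, since their lcm is `o C`; they are not on
        -- cycles of length `d` because `1 < d`.
        length-rows-≡ : o C ≡ d → length rows ≡ #cyclesOfLength d β * d + #fixedPoints β
        length-rows-≡ c≡d = trans
          (unique∧set⇒length≡ rows! (Unique.++⁺ (pointsOfLength! β d) (pointsOfLength! β 1) disjoint) rows⊆ ⊆rows)
          (trans (length-++ (pointsOfLength β d)) (cong₂ _+_ (length-pointsOfLength β d) (length-pointsOfLength-1 β)))
          where
          disjoint : ∀ {x} → ¬ (x ∈ pointsOfLength β d × x ∈ pointsOfLength β 1)
          disjoint (x∈d , x∈1) = ℕ.<⇒≢ 1<d (trans (sym (to (∈-pointsOfLength β) x∈1)) (to (∈-pointsOfLength β) x∈d))

          rows⊆ : rows ⊆ pointsOfLength β d ++ pointsOfLength β 1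
          rows⊆ {x} x∈ with lcm-len≡d⇒ x (to ∈-rows x∈)
          ... | inj₁ len≡1 = ∈-++⁺ʳ (pointsOfLength β d) (from (∈-pointsOfLength β) len≡1)
          ... | inj₂ len≡d = ∈-++⁺ˡ (from (∈-pointsOfLength β) len≡d)

          ⊆rows : pointsOfLength β d ++ pointsOfLength β 1 ⊆ rows
          ⊆rows x∈ with ∈-++⁻ (pointsOfLength β d) x∈
          ... | inj₁ x∈d = S⊆rows x∈d
          ... | inj₂ x∈1 = from ∈-rows (trans (cong (λ m → lcm m (o C)) (to (∈-pointsOfLength β) x∈1)) (trans lcm[1,c]≡c c≡d))

        -- After cancelling `d`, the number 2 would divide rc if c differs from d, and rd + f if c =
        -- d. The former is a product of odd numbers; in the latter f is even while r and d = c are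
        -- odd.
        2d∤length-cells : ¬ d * 2 ∣ length cells
        2d∤length-cells 2d∣ with o C ℕ.≟ d
        ... | no c≢d = odd*odd r-odd C-odd (*-cancelˡ-∣ d
          (subst (d * 2 ∣_) (trans length-cells (trans (cong (_* o C) (trans (length-rows-≢ c≢d) (ℕ.*-comm (#cyclesOfLength d β) d)))
            (ℕ.*-assoc d (#cyclesOfLength d β) (o C)))) 2d∣))
        ... | yes c≡d = odd*odd r-odd (subst Odd c≡d C-odd)
          (∣m+n∣m⇒∣n (subst (2 ∣_) (ℕ.+-comm _ (#fixedPoints β)) 2∣rd+f) f-even)
          where
          f-even : Even (#fixedPoints β)
          -- For odd f, (iii) would give `o C < d`, against `o C ≡ d`.
          f-even = decidable-stable (2 ∣? _) λ f-odd → ℕ.<⇒≢ (proj₂ (proj₂ C-inΓ) f-odd) c≡d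

          2∣rd+f : 2 ∣ #cyclesOfLength d β * d + #fixedPoints β
          2∣rd+f = *-cancelˡ-∣ d (subst (d * 2 ∣_)
            (trans length-cells (trans (cong₂ _*_ (length-rows-≡ c≡d) c≡d) (ℕ.*-comm _ d))) 2d∣)

        -- A search through the finite list settles it: if it finds nothing, every orbit has length
        -- 2d, so 2d divides |X|.
        fixedCell : ∃[ u ] (u ∈ cells × iter T d u ≡ u)
        fixedCell with Any.any? (λ u → iter T d u ≟ᶜ u) cells
        ... | yes found = let u , u∈ , e = find found in u , u∈ , e
        ... | no none = contradiction
          (commonPeriod∣length _≟ᶜ_ T (d * 2) {{ℕ.m*n≢0 d 2}} cells cells! cells-closed
            (cells-period λ u∈ e → none (lose u∈ e)))
          2d∤length-cells

        ¬even-d : ¬ Even d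
        -- The case k = 0 is treated apart, since `d` divides 0 and the comparison below needs a
        -- positive k.
        ¬even-d (divides zero d≡0) = contradiction (subst (1 <_) d≡0 1<d) λ ()
        ¬even-d (divides k@(suc _) d≡k*2) with fixedCell
        ... | u , u∈ , e = >⇒∤ (subst (k <_) (sym d≡k*2) (ℕ.m<m*n k 2 (ℕ.n<1+n 1)))
          (to (cells-even-period u∈ k) (trans (cong (λ m → iter T m u) (sym d≡k*2)) e))

        midpoint : ∀ k → d ≡ suc (k * 2) → ∃[ x ] (len β x ≡ d × entry L x (pow β k x) ∈ˢ C)
        midpoint k d≡ with fixedCell
        ... | u@(x , y) , u∈ , e = x , len≡d , subst (λ w → entry L x w ∈ˢ C) (sym y≡) (proj₁ (to ∈-cells u∈))
          where
          y≡ : pow β k x ≡ y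
          -- For d = 2k + 1, Tᵈ is T after T²ᵏ, so it puts xβᵏ in the column; the cell being fixed,
          -- this is y.
          y≡ = trans (cong proj₁ (sym (iter-T-even k x y)))
            (cong proj₂ (trans (cong (λ m → iter T m u) (sym d≡)) e))

          len≡d : len β x ≡ d
          len≡d with lcm-len≡d⇒ x (proj₂ (to ∈-cells u∈))
          ... | inj₂ len≡d = len≡d
          -- If β fixed x, then y = xβᵏ = x, so T² would fix the cell and `d` would divide 1.
          ... | inj₁ len≡1 = contradiction (to (cells-even-period u∈ 1) (cong₂ _,_ (fix 1)
                  (trans (cong (β ⟨$⟩ʳ_) (trans (sym y≡) (fix k))) (trans (fix 1) (trans (sym (fix k)) y≡)))))
                  (>⇒∤ 1<d)
            where
            fix : ∀ j → pow β j x ≡ x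
            fix j = from (len-period β x j) (subst (_∣ j) (sym len≡1) (1∣ j))

    -- Here x′ is xβʲ for some j. Powers of β commute, so T²ʲ carries the cell (x, xβᵏ) to (x′,
    -- x′βᵏ), and the symbol moves by γ²ʲ within its cycle.
    midpoint-cycle : ∀ k {x x′} → cycleOf β x ≡ cycleOf β x′ →
      cycleOf γ (entry L x (pow β k x)) ≡ cycleOf γ (entry L x′ (pow β k x′))
    midpoint-cycle k {x} {x′} e with to (∈-cycleOf β x x′) (subst (x′ ∈ˢ_) (sym e) (cycleOf-self β x′))
    ... | j , refl = sym (trans (cong (cycleOf γ) symbol≡) (cycleOf-pow γ (j * 2) _))
      where
      pow-swap : pow β k (pow β j x) ≡ pow β j (pow β k x)
      pow-swap = trans (sym (fold-+ x _ k)) (trans (cong (λ m → pow β m x) (ℕ.+-comm k j)) (fold-+ x _ j))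

      symbol≡ : entry L (pow β j x) (pow β k (pow β j x)) ≡ pow γ (j * 2) (entry L x (pow β k x))
      symbol≡ = trans (cong (entry L (pow β j x)) pow-swap)
        (trans (cong symbol (sym (iter-T-even j x (pow β k x)))) (symbol-iter (j * 2) (x , pow β k x)))

    -- Emptiness and size of Γ

    ∈Γ⁻ : ∀ {C} → C ∈ Γ β γ d → C ∈ cycles γ × InΓ β d C
    ∈Γ⁻ = ∈-filter⁻ (inΓ? β d) {xs = cycles γ}

    Γ-empty : Odd (#cyclesOfLength d β) → Even d → Γ β γ d ≡ []
    Γ-empty r-odd d-even with Γ β γ d | ∈Γ⁻
    ... | []    | _   = refl
    ... | C ∷ _ | inv = let C∈ , C-inΓ = inv (here refl)
                        in contradiction d-even (¬even-d C C∈ (proj₁ (proj₁ C-inΓ)) C-inΓ r-odd)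

    length-Γ : Odd (#cyclesOfLength d β) → Odd d → length (Γ β γ d) ≤ #cyclesOfLength d β
    length-Γ r-odd d-odd with odd⇒1+even d d-odd
    ... | k , d≡ = injectiveRel⇒length≤ {R = R} (Unique.filter⁺ (inΓ? β d) (cycles-unique γ)) R-injective image
      where
      -- `midpoint` supplies a partner of length `d` for each member of Γ, and `midpoint-cycle`
      -- shows that the partner determines that member; counting along this relation gives the
      -- bound.
      R : Subset n → Subset n → Set
      R C D = ∃[ x ] (D ≡ cycleOf β x × entry L x (pow β k x) ∈ˢ C)

      cycle≡ : ∀ {C z} → C ∈ cycles γ → z ∈ˢ C → cycleOf γ z ≡ C
      cycle≡ C∈ z∈ with ∈cycles⇒cycleOf γ C∈
      ... | _ , refl = ∈⇒cycleOf≡ γ z∈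

      R-injective : ∀ {C C′ D} → C ∈ Γ β γ d → C′ ∈ Γ β γ d → R C D → R C′ D → C ≡ C′
      R-injective C∈ C′∈ (x , D≡ , s∈) (x′ , D≡′ , s∈′) =
        trans (sym (cycle≡ (proj₁ (∈Γ⁻ C∈)) s∈))
          (trans (midpoint-cycle k (trans (sym D≡) D≡′)) (cycle≡ (proj₁ (∈Γ⁻ C′∈)) s∈′))

      image : ∀ {C} → C ∈ Γ β γ d → ∃[ D ] (D ∈ filter (λ C → o C ℕ.≟ d) (cycles β) × R C D)
      image {C} C∈ =
        let C∈cycles , C-inΓ = ∈Γ⁻ C∈
            x , len≡d , s∈ = midpoint C C∈cycles (proj₁ (proj₁ C-inΓ)) C-inΓ r-odd k d≡
        in cycleOf β x , ∈-filter⁺ (λ C → o C ℕ.≟ d) (cycleOf∈cycles β x) len≡d , x , refl , s∈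

theorem4p5 : (n : ℕ) (β γ : Permutation′ n) →
    Par n ⟨ id , β , γ ⨾12⟩ →
    (d : ℕ) → 1 < d →
    (r : ℕ) → r ≡ #cyclesOfLength d β → Odd r →
    (Even d → Γ β γ d ≡ []) × (Odd d → length (Γ β γ d) ≤ r)
theorem4p5 n β γ (L , aut) d 1<d r refl r-odd = Γ-empty β γ L aut 1<d r-odd , length-Γ β γ L aut 1<d r-odd
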